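{- Let $r\ge4$ and $s\in\{2,\dots,r-1\}$, and let $A=\{a_1,\dots,a_s\}$ and $B=\{b_1,\dots,b_s\}$ be two different $s$-partitions of $r$. Then the graphs $\widehat K_r(A)$ and $\widehat K_r(B)$ are non-isomorphic, and they are isospectral both for the standard Laplacian and for the signless standard Laplacian.
   Context: An $s$-partition of $r\in\mathbb N$ is a multiset $\{a_1,\dots,a_s\}$ of positive integers with $a_1+\dots+a_s=r$. $\widehat K_r$ is the graph obtained from the complete graph $K_r$ (vertices $w_1,\dots,w_r$) by attaching a pendant vertex $v_i$ to each $w_i$ via an edge $\{w_i,v_i\}$. For an $s$-partition $A=\{a_1,\dots,a_s\}$ of $r$, $\widehat K_r(A)$ is the quotient graph obtained from $\widehat K_r$ by contracting (identifying) the vertex sets $\{v_1,\dots,v_{a_1}\}$, $\{v_{a_1+1},\dots,v_{a_1+a_2}\}$, …, $\{v_{a_1+\dots+a_{s-1}+1},\dots,v_r\}$ each into a single vertex, keeping all edges; thus $\widehat K_r(A)$ consists of $K_r$ together with $s$ further vertices, the $j$-th adjacent exactly to the $a_j$ vertices $w_i$ of the $j$-th block. The standard Laplacian is $(\Delta_G f)(v)=f(v)-\frac{1}{\deg v}\sum_{u\in N_v}f(u)$ and the signless standard Laplacian is $(\Delta_{G^+}f)(v)=f(v)+\frac{1}{\deg v}\sum_{u\in N_v}f(u)$ (equivalently $I\mp D^{ -1/2}AD^{ -1/2}$). Two graphs are isospectral for an operator if the operators have the same eigenvalues with multiplicities. -}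

module Defs where

open import Level using (0ℓ; _⊔_)
open import Algebra.Apartness.Bundles using (HeytingField; HeytingCommutativeRing)
open import Algebra.Bundles using (CommutativeRing)
import Algebra.Definitions.RawMonoid as RawMonoidDefs
open import Data.Empty using (⊥)
open import Data.Fin.Base as Fin using (Fin; zero; suc; splitAt; _↑ʳ_)
import Data.Fin.Properties as Fin
open import Data.List.Base as List using (List; length; filter; foldr; tabulate)
open import Data.List.Relation.Binary.Permutation.Propositional using (_↭_)
open import Data.Nat.Base using (ℕ; zero; suc; _+_; _<_)
open import Data.Product.Base using (Σ-syntax; ∃; ∃-syntax; ∃₂; _×_; _,_; proj₁)
open import Data.Sum.Base using (_⊎_; inj₁; inj₂; [_,_]′; map₂)
import Data.Sum.Properties as Sum
open import Data.Vec.Base as Vec using (Vec; []; _∷_)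
open import Data.Vec.Relation.Unary.All using (All; []; _∷_)
open import Function.Base using (_∘_)
open import Function.Bundles using (_↔_; _⇔_; _↠_; mk↠ₛ; Inverse; module Surjection)
open import Function.Definitions using (StrictlySurjective)
open import Function.Properties.Inverse using (↔⇒↣; ↔-sym)
open import Relation.Binary.Core using (Rel)
open import Relation.Binary.Definitions using (Decidable; DecidableEquality)
open import Relation.Binary.PropositionalEquality
  using (_≡_; _≢_; refl; sym; trans; cong; subst)
open import Relation.Nullary using (Dec; yes; no; ¬_)
open import Relation.Nullary.Decidable as Dec using (¬?; _×-dec_)

------------------------------------------------------------------------
-- Finite simple graphs

record Graph : Set₁ where
  infix 4 _~_ _~?_
  field
    Vertex   : Set
    order    : ℕ
    index    : Vertex ↔ Fin order
    _~_      : Rel Vertex 0ℓ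
    _~?_     : Decidable _~_
    ~-sym    : ∀ {u v} → u ~ v → v ~ u
    ~-irrefl : ∀ {v} → ¬ (v ~ v)

  vertices : List Vertex
  vertices = tabulate (Inverse.from index)

  neighbours : Vertex → List Vertex
  neighbours v = filter (v ~?_) vertices

  degree : Vertex → ℕ
  degree v = length (neighbours v)

infix 4 _≅_

_≅_ : Graph → Graph → Set
G ≅ H = Σ[ φ ∈ (G.Vertex ↔ H.Vertex) ]
          (∀ u v → (u G.~ v) ⇔ (Inverse.to φ u H.~ Inverse.to φ v))
  where
  module G = Graph G
  module H = Graph H

-- The quotient graph identifying the vertices in each fibre of π, where π
-- never identifies adjacent vertices. Edges are kept as a relation, so this
-- agrees with keeping all edges as long as no two edges become parallel.
module _ (G : Graph) {W : Set} {n : ℕ} (W↔ : W ↔ Fin n)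
         (π : Graph.Vertex G ↠ W) where
  open Graph G
  open Surjection π using (to)

  contract : (∀ {u v} → u ~ v → to u ≢ to v) → Graph
  contract loopless = record
    { Vertex   = W
    ; order    = n
    ; index    = W↔
    ; _~_      = λ x y → ∃₂ λ u v → u ~ v × to u ≡ x × to v ≡ y
    ; _~?_     = decide
    ; ~-sym    = λ { (u , v , u~v , p , q) → v , u , ~-sym u~v , q , p }
    ; ~-irrefl = λ { (u , v , u~v , p , q) → loopless u~v (trans p (sym q)) }
    }
    where
    _≟_ : DecidableEquality W
    _≟_ = Fin.inj⇒≟ (↔⇒↣ W↔)

    any : ∀ {P : Vertex → Set} → (∀ v → Dec (P v)) → Dec (∃ P)
    any {P} P? = Dec.map′
      (λ { (i , p) → Inverse.from index i , p })
      (λ { (v , p) → Inverse.to index v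
                   , subst P (sym (Inverse.strictlyInverseʳ index v)) p })
      (Fin.any? (P? ∘ Inverse.from index))

    decide : ∀ x y → Dec (∃₂ λ u v → u ~ v × to u ≡ x × to v ≡ y)
    decide x y = any λ u → any λ v → (u ~? v) ×-dec (to u ≟ x) ×-dec (to v ≟ y)

------------------------------------------------------------------------
-- K̂ r: the clique vertices wᵢ are inj₁ i, the pendant vertices vᵢ are inj₂ i

K̂Adj : ∀ r → Rel (Fin r ⊎ Fin r) 0ℓ
K̂Adj r (inj₁ i) (inj₁ j) = i ≢ j
K̂Adj r (inj₁ i) (inj₂ j) = i ≡ j
K̂Adj r (inj₂ i) (inj₁ j) = i ≡ j
K̂Adj r (inj₂ i) (inj₂ j) = ⊥

K̂ : ℕ → Graph
K̂ r = record
  { Vertex   = Fin r ⊎ Fin r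
  ; order    = r + r
  ; index    = ↔-sym Fin.+↔⊎
  ; _~_      = K̂Adj r
  ; _~?_     = adj?
  ; ~-sym    = λ {u} {v} → symm u v
  ; ~-irrefl = λ {v} → irrefl v
  }
  where
  adj? : Decidable (K̂Adj r)
  adj? (inj₁ i) (inj₁ j) = ¬? (i Fin.≟ j)
  adj? (inj₁ i) (inj₂ j) = i Fin.≟ j
  adj? (inj₂ i) (inj₁ j) = i Fin.≟ j
  adj? (inj₂ i) (inj₂ j) = no λ ()

  symm : ∀ u v → K̂Adj r u v → K̂Adj r v u
  symm (inj₁ i) (inj₁ j) i≢j = i≢j ∘ sym
  symm (inj₁ i) (inj₂ j) i≡j = sym i≡j
  symm (inj₂ i) (inj₁ j) i≡j = sym i≡j

  irrefl : ∀ v → ¬ K̂Adj r v v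
  irrefl (inj₁ i) i≢i = i≢i refl

------------------------------------------------------------------------
-- Partitions

-- An s-partition of r, given by a listing a₁, …, aₛ of its parts. Different
-- listings may describe the same multiset, so equality of partitions is _≋_.
record Partition (r s : ℕ) : Set where
  field
    parts    : Vec ℕ s
    positive : All (0 <_) parts
    total    : Vec.sum parts ≡ r

infix 4 _≋_

_≋_ : ∀ {r s} → Partition r s → Partition r s → Set
A ≋ B = Vec.toList (Partition.parts A) ↭ Vec.toList (Partition.parts B)

-- The index j of the consecutive block of length aⱼ containing a position.
blockOf : ∀ {s} (as : Vec ℕ s) → Fin (Vec.sum as) → Fin s
blockOf (a ∷ as) i = [ (λ _ → zero) , (λ k → suc (blockOf as k)) ]′ (splitAt a i)

blockOf-surjective : ∀ {s} {as : Vec ℕ s} → All (0 <_) as →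
                     StrictlySurjective _≡_ (blockOf as)
blockOf-surjective {as = suc a ∷ as} (_ ∷ _)  zero    = zero , refl
blockOf-surjective {as = a ∷ as}     (_ ∷ ps) (suc j) with blockOf-surjective ps j
... | i , eq = a ↑ʳ i , trans
  (cong [ (λ _ → zero) , (λ k → suc (blockOf as k)) ]′ (Fin.splitAt-↑ʳ a (Vec.sum as) i))
  (cong suc eq)

module _ {r s : ℕ} (A : Partition r s) where
  open Partition A

  block : Fin r → Fin s
  block i = blockOf parts (Fin.cast (sym total) i)

  block-surjective : StrictlySurjective _≡_ block
  block-surjective j with blockOf-surjective positive j
  ... | i , eq = Fin.cast total i , trans
    (cong (blockOf parts) (Fin.cast-involutive (sym total) total i)) eq

  identify : (Fin r ⊎ Fin r) ↠ (Fin r ⊎ Fin s)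
  identify = mk↠ₛ {to = map₂ block} surj
    where
    surj : StrictlySurjective _≡_ (map₂ block)
    surj (inj₁ i) = inj₁ i , refl
    surj (inj₂ j) with block-surjective j
    ... | i , eq = inj₂ i , cong inj₂ eq

  -- No parallel edges arise, as the vᵢ have pairwise distinct neighbours wᵢ.
  K̂[_] : Graph
  K̂[_] = contract (K̂ r) (↔-sym Fin.+↔⊎) identify (λ {u} {v} → loopless u v)
    where
    loopless : ∀ u v → K̂Adj r u v → map₂ block u ≢ map₂ block v
    loopless (inj₁ i) (inj₁ j) i≢j eq = i≢j (Sum.inj₁-injective eq)
    loopless (inj₁ i) (inj₂ j) _   ()
    loopless (inj₂ i) (inj₁ j) _   ()

------------------------------------------------------------------------
-- Spectra over a field of characteristic zero

-- The library has no real numbers; everything here is parametrised by a field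
-- F of characteristic zero, with ℝ and ℂ as the intended instances. A Heyting
-- field has x invertible iff x # 0#; a classical field is one, with x # y
-- meaning ¬ (x ≈ y).
module Spectral {c ℓ₁ ℓ₂} (F : HeytingField c ℓ₁ ℓ₂) where
  open HeytingField F
    renaming (_+_ to _+F_; _-_ to _-F_; refl to ≈-refl; sym to ≈-sym; trans to ≈-trans)
  open CommutativeRing (HeytingCommutativeRing.commutativeRing heytingCommutativeRing)
    using (+-rawMonoid)
  open RawMonoidDefs +-rawMonoid using (sum) renaming (_×_ to _·_)

  CharacteristicZero : Set ℓ₂
  CharacteristicZero = ∀ n → (suc n · 1#) # 0#

  Operator : Set → Set c
  Operator V = (V → Carrier) → (V → Carrier)

  module _ (char0 : CharacteristicZero) where

    -- The value at zero is only ever multiplied by an empty sum.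
    1/_ : ℕ → Carrier
    1/ zero  = 0#
    1/ suc n = proj₁ (#⇒invertible (char0 n))

    module _ (G : Graph) where
      open Graph G

      neighbourSum : Operator Vertex
      neighbourSum f v = foldr _+F_ 0# (List.map f (neighbours v))

      Δ : Operator Vertex
      Δ f v = f v -F (1/ degree v) * neighbourSum f v

      Δ⁺ : Operator Vertex
      Δ⁺ f v = f v +F (1/ degree v) * neighbourSum f v

  combination : ∀ {V : Set} {d} → (Fin d → Carrier) → (Fin d → V → Carrier) →
                V → Carrier
  combination a b v = sum (λ i → a i * b i v)

  module _ {V : Set} (T : Operator V) where

    -- Membership in the μ-eigenspace; the zero function is not excluded.
    InEigenspace : Carrier → (V → Carrier) → Set ℓ₁
    InEigenspace μ f = ∀ v → T f v ≈ μ * f v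

    record IsEigenbasis (μ : Carrier) {d : ℕ} (b : Fin d → V → Carrier) :
                        Set (c ⊔ ℓ₁) where
      field
        inEigenspace : ∀ i → InEigenspace μ (b i)
        independent  : ∀ a → (∀ v → combination a b v ≈ 0#) → ∀ i → a i ≈ 0#
        spanning     : ∀ f → InEigenspace μ f →
                       ∃[ a ] (∀ v → f v ≈ combination a b v)

    -- The multiplicity of an eigenvalue is the dimension of its eigenspace;
    -- it is 0 exactly when μ is not an eigenvalue. For the Laplacians over ℝ
    -- it is also the algebraic multiplicity, as they are self-adjoint for the
    -- inner product Σ_v deg(v) f(v) g(v).
    HasMultiplicity : Carrier → ℕ → Set (c ⊔ ℓ₁)
    HasMultiplicity μ d = ∃[ b ] IsEigenbasis μ {d} b

  Isospectral : ∀ {V W : Set} → Operator V → Operator W → Set (c ⊔ ℓ₁)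
  Isospectral T U = ∀ μ d → HasMultiplicity T μ d ⇔ HasMultiplicity U μ d

{-# OPTIONS --safe #-}
module Submission where

-- All clique vertices have degree r and the pendant vertices have the block
-- sizes as degrees, so the degree sequence recovers the partition.
--
-- Isospectrality: Δ = I - P and Δ⁺ = I + P with P = D⁻¹ · adjacency. A function
-- on the clique is uniquely a pullback of a function on the blocks plus a
-- function h with vanishing block sums, and P(h, 0) = (-h/r, 0). On the
-- remaining pairs (u, g) of functions on the blocks, P acts by
-- (u, g) ↦ ((a(u)·1 - u + g)/r, u), where a(u) = Σⱼ aⱼuⱼ. Up to isomorphism the
-- operator thus depends only on r - s and on the pair (1, a) with a(1) = r; the
-- map u ↦ u + (a(u) - b(u))/r · 1 fixes 1 and carries a to b. So P for A and P
-- for B are conjugate by an explicit rational map, which transports eigenbases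
-- without deciding which scalars are eigenvalues.

open import Defs
open import Level using (_⊔_)
open import Algebra.Apartness.Bundles using (HeytingField; HeytingCommutativeRing)
open import Algebra.Bundles using (Semiring; CommutativeRing)
import Algebra.Properties.Semiring.Sum as SemiringSum
import Algebra.Properties.CommutativeMonoid.Sum as MonoidSum
open import Data.Bool.Base using (true; false; if_then_else_)
open import Data.Fin.Base as Fin using (Fin; zero; suc; splitAt)
import Data.Fin.Properties as Fin
open import Data.Fin.Permutation as Perm
  using (Permutation′; _⟨$⟩ʳ_; _⟨$⟩ˡ_; _∘ₚ_; inverseˡ; inverseʳ)
import Data.Fin.Permutation.Components as PC
open import Data.List.Base as List using (List; []; _∷_; length; filter; foldr; tabulate)
import Data.List.Properties as List
open import Data.List.Relation.Binary.Permutation.Propositional using (_↭_; module PermutationReasoning)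
import Data.List.Relation.Binary.Permutation.Propositional.Properties as ↭
open import Data.Nat.Base as ℕ using (ℕ; zero; suc; _≤_; _<_)
import Data.Nat.Properties as ℕ
open import Data.Product.Base using (Σ-syntax; _×_; _,_; proj₁; proj₂)
open import Data.Sum.Base as Sum using (_⊎_; inj₁; inj₂; [_,_]′)
import Data.Sum.Properties as Sum
open import Data.Vec.Base as Vec using (Vec; []; _∷_)
import Data.Vec.Relation.Unary.All.Properties as All
open import Function.Base using (_∘_; const)
open import Function.Bundles using (_⇔_; mk⇔; Equivalence; Inverse; Injection)
open import Function.Definitions using (Injective)
open import Function.Construct.Composition using (_↔-∘_)
open import Function.Properties.Inverse using (↔⇒↣; ↔-sym)
open import Relation.Binary.PropositionalEquality as ≡
  using (_≡_; _≢_; refl; cong; cong₂)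
open import Relation.Nullary using (Dec; yes; no; does; ¬_)
open import Relation.Nullary.Decidable using (¬?; does-⇔; dec-true; dec-false)
open import Relation.Unary using (Pred; Decidable)

-- Finite sums with indicator coefficients over a semiring

module IndicatorSum {c ℓ} (S : Semiring c ℓ) where
  open Semiring S hiding (zero) renaming (refl to ≈-refl; sym to ≈-sym; trans to ≈-trans)
  open SemiringSum S public
  open import Relation.Binary.Reasoning.Setoid setoid

  ⟦_⟧ : ∀ {p} {P : Set p} → Dec P → Carrier
  ⟦ P? ⟧ = if does P? then 1# else 0#

  -- An indicator depends only on `does`, so the search that decides adjacency in a quotient graph
  -- can be replaced by any decision of an equivalent proposition.
  ⟦⟧-cong : ∀ {p q} {P : Set p} {Q : Set q} → P ⇔ Q → (P? : Dec P) (Q? : Dec Q) →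
            ⟦ P? ⟧ ≡ ⟦ Q? ⟧
  ⟦⟧-cong P⇔Q P? Q? = cong (if_then 1# else 0#) (does-⇔ P⇔Q P? Q?)

  sum-filter : ∀ {a p} {A : Set a} {P : Pred A p} (P? : Decidable P) (f : A → Carrier)
               {n} (g : Fin n → A) →
               foldr _+_ 0# (List.map f (filter P? (tabulate g))) ≈
               sum (λ i → ⟦ P? (g i) ⟧ * f (g i))
  sum-filter P? f {zero}  g = ≈-refl
  sum-filter P? f {suc n} g with does (P? (g zero))
  ... | true  = +-cong (≈-sym (*-identityˡ _)) (sum-filter P? f (g ∘ suc))
  ... | false = ≈-trans (sum-filter P? f (g ∘ suc))
                  (≈-sym (≈-trans (+-congʳ (zeroˡ _)) (+-identityˡ _)))

  sum-zero : ∀ {n} {f : Fin n → Carrier} → (∀ i → f i ≈ 0#) → sum f ≈ 0#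
  sum-zero {n} f≈0 = ≈-trans (sum-cong-≋ f≈0) (sum-replicate-zero n)

  sum-δ : ∀ {n} (j : Fin n) (f : Fin n → Carrier) → sum (λ i → ⟦ j Fin.≟ i ⟧ * f i) ≈ f j
  sum-δ zero    f = begin
    1# * f zero + sum (λ i → 0# * f (suc i))  ≈⟨ +-cong (*-identityˡ _) (sum-zero (λ i → zeroˡ (f (suc i)))) ⟩
    f zero + 0#                               ≈⟨ +-identityʳ _ ⟩
    f zero                                    ∎
  sum-δ (suc j) f = ≈-trans (+-cong (zeroˡ _) (sum-δ j (f ∘ suc))) (+-identityˡ _)

  sum-complement : ∀ {n p} {P : Pred (Fin n) p} (P? : Decidable P) (f : Fin n → Carrier) →
                   sum (λ i → ⟦ ¬? (P? i) ⟧ * f i) + sum (λ i → ⟦ P? i ⟧ * f i) ≈ sum f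
  sum-complement P? f = ≈-trans (≈-sym (∑-distrib-+ (λ i → ⟦ ¬? (P? i) ⟧ * f i) (λ i → ⟦ P? i ⟧ * f i)))
    (sum-cong-≋ pointwise)
    where
    pointwise : ∀ i → ⟦ ¬? (P? i) ⟧ * f i + ⟦ P? i ⟧ * f i ≈ f i
    pointwise i with does (P? i)
    ... | true  = ≈-trans (+-cong (zeroˡ _) (*-identityˡ _)) (+-identityˡ _)
    ... | false = ≈-trans (+-cong (*-identityˡ _) (zeroˡ _)) (+-identityʳ _)

  sum-splitAt : ∀ m {n} (f : Fin m ⊎ Fin n → Carrier) →
                sum (f ∘ splitAt m) ≈ sum (f ∘ inj₁) + sum (f ∘ inj₂)
  sum-splitAt zero    f = ≈-sym (+-identityˡ _)
  sum-splitAt (suc m) f = ≈-trans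
    (+-congˡ (sum-splitAt m (f ∘ Sum.map suc (λ j → j)))) (≈-sym (+-assoc _ _ _))

  fibreSum : ∀ {r s} → (Fin r → Fin s) → (Fin r → Carrier) → Fin s → Carrier
  fibreSum p f j = sum (λ i → ⟦ p i Fin.≟ j ⟧ * f i)

  sum-fibreSum : ∀ {r s} (p : Fin r → Fin s) f → sum (fibreSum p f) ≈ sum f
  sum-fibreSum p f = begin
    sum (fibreSum p f)                                  ≈⟨ ∑-comm (λ j i → ⟦ p i Fin.≟ j ⟧ * f i) ⟩
    sum (λ i → sum (λ j → ⟦ p i Fin.≟ j ⟧ * f i))       ≈⟨ sum-cong-≋ (λ i → sum-δ (p i) (λ _ → f i)) ⟩
    sum f                                               ∎

  fibreSum-pullback : ∀ {r s} (p : Fin r → Fin s) u j →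
                      fibreSum p (u ∘ p) j ≈ fibreSum p (λ _ → 1#) j * u j
  fibreSum-pullback p u j = ≈-trans (sum-cong-≋ pointwise) 
    (≈-sym (*-distribʳ-sum (u j) (λ i → ⟦ p i Fin.≟ j ⟧ * 1#)))
    where
    pointwise : ∀ i → ⟦ p i Fin.≟ j ⟧ * u (p i) ≈ ⟦ p i Fin.≟ j ⟧ * 1# * u j
    pointwise i with p i Fin.≟ j
    ... | yes refl = ≈-sym (*-congʳ (*-identityʳ _))
    ... | no _     = ≈-trans (zeroˡ _) (≈-sym (≈-trans (*-congʳ (zeroˡ _)) (zeroˡ _)))

  -- Over `ℕ` and at the constant function `1` this is the degree; over the field it is the
  -- neighbour sum in both Laplacians. One computation over semirings thus serves the degrees and
  -- the spectra.
  neighbourTotal : (G : Graph) → (Graph.Vertex G → Carrier) → Graph.Vertex G → Carrier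
  neighbourTotal G f v = foldr _+_ 0# (List.map f (Graph.neighbours G v))

  -- Neighbourhoods in `K̂[ A ]`

  module _ {r s} (A : Partition r s) where
    open Graph K̂[ A ]

    private
      neighbourTotal-split : ∀ f v → neighbourTotal K̂[ A ] f v ≈
        sum (λ i → ⟦ v ~? inj₁ i ⟧ * f (inj₁ i)) + sum (λ j → ⟦ v ~? inj₂ j ⟧ * f (inj₂ j))
      neighbourTotal-split f v = ≈-trans (sum-filter (v ~?_) f (splitAt r))
        (sum-splitAt r (λ u → ⟦ v ~? u ⟧ * f u))

      ⟦~?⟧ : ∀ {q} {Q : Set q} {u v} → (u ~ v ⇔ Q) → (Q? : Dec Q) (x : Carrier) →
             ⟦ u ~? v ⟧ * x ≈ ⟦ Q? ⟧ * x
      ⟦~?⟧ {u = u} {v} eq Q? x = *-congʳ (reflexive (⟦⟧-cong eq (u ~? v) Q?))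

    clique-adjacency : ∀ i k → (inj₁ i ~ inj₁ k) ⇔ (i ≢ k)
    clique-adjacency i k = mk⇔
      (λ { (inj₁ _ , inj₁ _ , i≢k , refl , refl) → i≢k
         ; (inj₂ _ , _ , _ , () , _)
         ; (inj₁ _ , inj₂ _ , _ , _ , ()) })
      (λ i≢k → inj₁ i , inj₁ k , i≢k , refl , refl)

    pendant-adjacency : ∀ i j → (inj₁ i ~ inj₂ j) ⇔ (block A i ≡ j)
    pendant-adjacency i j = mk⇔
      (λ { (inj₁ i , inj₂ .i , refl , refl , eq) → Sum.inj₂-injective eq
         ; (inj₁ _ , inj₁ _ , _ , _ , ())
         ; (inj₂ _ , _ , _ , () , _) })
      (λ { refl → inj₁ i , inj₂ i , refl , refl , refl })

    pendants-nonadjacent : ∀ j k → ¬ (inj₂ j ~ inj₂ k)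
    pendants-nonadjacent j k (inj₂ _ , inj₂ _ , () , _ , _)
    pendants-nonadjacent j k (inj₁ _ , _ , _ , () , _)
    pendants-nonadjacent j k (inj₂ _ , inj₁ _ , _ , _ , ())

    -- The term `f (inj₁ i)` completes the sum over the other clique vertices to a sum over the
    -- whole clique. It stands on the left because a semiring has no subtraction.
    neighbourTotal-clique : ∀ f i →
      neighbourTotal K̂[ A ] f (inj₁ i) + f (inj₁ i) ≈ sum (f ∘ inj₁) + f (inj₂ (block A i))
    neighbourTotal-clique f i = begin
      neighbourTotal K̂[ A ] f (inj₁ i) + f (inj₁ i)
        ≈⟨ +-congʳ (neighbourTotal-split f (inj₁ i)) ⟩
      sum (λ k → ⟦ inj₁ i ~? inj₁ k ⟧ * f (inj₁ k)) +
      sum (λ j → ⟦ inj₁ i ~? inj₂ j ⟧ * f (inj₂ j)) + f (inj₁ i)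
        ≈⟨ +-congʳ (+-cong
             (sum-cong-≋ (λ k → ⟦~?⟧ (clique-adjacency i k) (¬? (i Fin.≟ k)) _))
             (≈-trans
               (sum-cong-≋ (λ j → ⟦~?⟧ (pendant-adjacency i j) (block A i Fin.≟ j) _))
               (sum-δ (block A i) (f ∘ inj₂)))) ⟩
      others + f (inj₂ (block A i)) + f (inj₁ i)
        ≈⟨ +-assoc _ _ _ ⟩
      others + (f (inj₂ (block A i)) + f (inj₁ i))
        ≈⟨ +-congˡ (+-comm _ _) ⟩
      others + (f (inj₁ i) + f (inj₂ (block A i)))
        ≈⟨ +-assoc _ _ _ ⟨
      others + f (inj₁ i) + f (inj₂ (block A i))
        ≈⟨ +-congʳ (+-congˡ (sum-δ i (f ∘ inj₁))) ⟨
      others + sum (λ k → ⟦ i Fin.≟ k ⟧ * f (inj₁ k)) + f (inj₂ (block A i))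
        ≈⟨ +-congʳ (sum-complement (i Fin.≟_) (f ∘ inj₁)) ⟩
      sum (f ∘ inj₁) + f (inj₂ (block A i)) ∎
      where others = sum (λ k → ⟦ ¬? (i Fin.≟ k) ⟧ * f (inj₁ k))

    neighbourTotal-pendant : ∀ f j →
      neighbourTotal K̂[ A ] f (inj₂ j) ≈ fibreSum (block A) (f ∘ inj₁) j
    neighbourTotal-pendant f j = begin
      neighbourTotal K̂[ A ] f (inj₂ j)
        ≈⟨ neighbourTotal-split f (inj₂ j) ⟩
      sum (λ i → ⟦ inj₂ j ~? inj₁ i ⟧ * f (inj₁ i)) + sum (λ k → ⟦ inj₂ j ~? inj₂ k ⟧ * f (inj₂ k))
        ≈⟨ +-cong
             (sum-cong-≋ (λ i → ⟦~?⟧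
               (mk⇔ (λ e → Equivalence.to (pendant-adjacency i j) (~-sym {inj₂ j} {inj₁ i} e))
                    (λ e → ~-sym {inj₁ i} {inj₂ j} (Equivalence.from (pendant-adjacency i j) e)))
               (block A i Fin.≟ j) _))
             (sum-zero (λ k → ≈-trans
               -- A second decision of the same proposition, chosen because its indicator computes
               -- to `0#`.
               (⟦~?⟧ (mk⇔ (λ e → e) (λ e → e)) (no (pendants-nonadjacent j k)) _)
               (zeroˡ _))) ⟩
      fibreSum (block A) (f ∘ inj₁) j + 0#
        ≈⟨ +-identityʳ _ ⟩
      fibreSum (block A) (f ∘ inj₁) j ∎

-- Tabulated lists up to permutation

tabulate-permute : ∀ {a} {A : Set a} {m n} (f : Fin n → A) (π : Perm.Permutation m n) →
                   tabulate (λ i → f (π ⟨$⟩ʳ i)) ↭ tabulate f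
tabulate-permute {A = A} f π = begin
  -- A list is the sum of its singletons in the commutative monoid of lists under `++` up to `↭`, so
  -- invariance of sums under reindexing applies.
  tabulate (λ i → f (π ⟨$⟩ʳ i))             ≡⟨ tabulate-as-sum (λ i → f (π ⟨$⟩ʳ i)) ⟩
  sum (λ i → List.[ f (π ⟨$⟩ʳ i) ])         ↭⟨ sum-permute (λ i → List.[ f i ]) π ⟨
  sum (λ i → List.[ f i ])                  ≡⟨ tabulate-as-sum f ⟨
  tabulate f                                ∎
  where
  open PermutationReasoning
  open MonoidSum (↭.++-commutativeMonoid {A = A}) using (sum; sum-permute)
  tabulate-as-sum : ∀ {n} (f : Fin n → A) → tabulate f ≡ sum (λ i → List.[ f i ])
  tabulate-as-sum {zero}  f = refl
  tabulate-as-sum {suc n} f = cong (f zero ∷_) (tabulate-as-sum (f ∘ suc))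

tabulate-splitAt : ∀ {a} {A : Set a} m {n} (f : Fin m ⊎ Fin n → A) →
                   tabulate (f ∘ splitAt m) ≡ tabulate (f ∘ inj₁) List.++ tabulate (f ∘ inj₂)
tabulate-splitAt zero    f = refl
tabulate-splitAt (suc m) f = cong (f (inj₁ zero) ∷_) (tabulate-splitAt m (f ∘ Sum.map suc (λ j → j)))

tabulate-lookup : ∀ {a} {A : Set a} {n} (xs : Vec A n) →
                  tabulate (Vec.lookup xs) ≡ Vec.toList xs
tabulate-lookup []       = refl
tabulate-lookup (x ∷ xs) = cong (x ∷_) (tabulate-lookup xs)

++-cancelˡ-↭ : ∀ {a} {A : Set a} (zs : List A) {xs ys} →
               zs List.++ xs ↭ zs List.++ ys → xs ↭ ys
++-cancelˡ-↭ []       p = p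
++-cancelˡ-↭ (z ∷ zs) p = ++-cancelˡ-↭ zs (↭.drop-∷ p)

-- Degree sequences and non-isomorphism

degreeSequence : Graph → List ℕ
degreeSequence G = tabulate (degree ∘ Inverse.from index)
  where open Graph G

module _ where
  open IndicatorSum ℕ.+-*-semiring

  length-as-sum : ∀ {a} {A : Set a} (xs : List A) →
                  length xs ≡ foldr ℕ._+_ 0 (List.map (const 1) xs)
  length-as-sum []       = refl
  length-as-sum (x ∷ xs) = cong suc (length-as-sum xs)

  sum-const : ∀ n x → sum {n} (const x) ≡ n ℕ.* x
  sum-const zero    x = refl
  sum-const (suc n) x = cong (x ℕ.+_) (sum-const n x)

  degree-clique : ∀ {r s} (A : Partition r s) i → Graph.degree K̂[ A ] (inj₁ i) ≡ r
  -- The cancelled `1` is the value at the vertex itself, which `neighbourTotal-clique` adds; the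
  -- `1` on the other side is the single pendant neighbour.
  degree-clique {r} A i = ℕ.+-cancelʳ-≡ 1 _ _ (begin
    degree (inj₁ i) ℕ.+ 1                               ≡⟨ cong (ℕ._+ 1) (length-as-sum (neighbours (inj₁ i))) ⟩
    neighbourTotal K̂[ A ] (const 1) (inj₁ i) ℕ.+ 1      ≡⟨ neighbourTotal-clique A (const 1) i ⟩
    sum {r} (const 1) ℕ.+ 1                             ≡⟨ cong (ℕ._+ 1) (≡.trans (sum-const r 1) (ℕ.*-identityʳ r)) ⟩
    r ℕ.+ 1                                             ∎)
    where
    open Graph K̂[ A ]
    open ≡.≡-Reasoning

  fibreSum-blockOf : ∀ {s} (as : Vec ℕ s) j → fibreSum (blockOf as) (const 1) j ≡ Vec.lookup as j
  fibreSum-blockOf (a ∷ as) j = begin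
    fibreSum (blockOf (a ∷ as)) (const 1) j
      ≡⟨ sum-splitAt a (λ k → ⟦ [ const zero , suc ∘ blockOf as ]′ k Fin.≟ j ⟧ ℕ.* 1) ⟩
    sum {a} (λ _ → ⟦ zero Fin.≟ j ⟧ ℕ.* 1) ℕ.+ fibreSum (suc ∘ blockOf as) (const 1) j
      ≡⟨ split j ⟩
    Vec.lookup (a ∷ as) j ∎
    where
    open ≡.≡-Reasoning

    split : ∀ j → sum {a} (λ _ → ⟦ zero Fin.≟ j ⟧ ℕ.* 1) ℕ.+ fibreSum (suc ∘ blockOf as) (const 1) j
                  ≡ Vec.lookup (a ∷ as) j
    split zero    = begin
      sum {a} (const 1) ℕ.+ sum {Vec.sum as} (const 0)  ≡⟨ cong₂ ℕ._+_ (sum-const a 1) (sum-const (Vec.sum as) 0) ⟩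
      a ℕ.* 1 ℕ.+ Vec.sum as ℕ.* 0                      ≡⟨ cong₂ ℕ._+_ (ℕ.*-identityʳ a) (ℕ.*-zeroʳ (Vec.sum as)) ⟩
      a ℕ.+ 0                                           ≡⟨ ℕ.+-identityʳ a ⟩
      a                                                 ∎
    split (suc j) = cong₂ ℕ._+_ (≡.trans (sum-const a 0) (ℕ.*-zeroʳ a)) (fibreSum-blockOf as j)

  degree-pendant : ∀ {r s} (A : Partition r s) j →
                   Graph.degree K̂[ A ] (inj₂ j) ≡ Vec.lookup (Partition.parts A) j
  -- Matching `total` with `refl` turns the cast inside `block` into a cast along `refl`, which is
  -- the identity.
  degree-pendant A@record { parts = as ; total = refl } j = begin
    degree (inj₂ j)                            ≡⟨ length-as-sum (neighbours (inj₂ j)) ⟩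
    neighbourTotal K̂[ A ] (const 1) (inj₂ j)   ≡⟨ neighbourTotal-pendant A (const 1) j ⟩
    fibreSum (block A) (const 1) j
      ≡⟨ sum-cong-≗ (λ i → cong (λ k → ⟦ blockOf as k Fin.≟ j ⟧ ℕ.* 1) (Fin.cast-is-id refl i)) ⟩
    fibreSum (blockOf as) (const 1) j          ≡⟨ fibreSum-blockOf as j ⟩
    Vec.lookup as j                            ∎
    where
    open Graph K̂[ A ]
    open ≡.≡-Reasoning

  module _ (G H : Graph) (G≅H : G ≅ H) where
    private
      module G = Graph G
      module H = Graph H
      open Inverse (proj₁ G≅H) using (to)

    reindexing : Perm.Permutation G.order H.order
    reindexing = H.index ↔-∘ (proj₁ G≅H ↔-∘ ↔-sym G.index)

    from-reindexing : ∀ i → Inverse.from H.index (reindexing ⟨$⟩ʳ i) ≡ to (Inverse.from G.index i)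
    from-reindexing i = Inverse.strictlyInverseʳ H.index _

    -- As a sum of indicators over all indices, the degree needs no comparison of filtered lists:
    -- the isomorphism preserves each indicator and permutes the summands.
    degree-≅ : ∀ u → G.degree u ≡ H.degree (to u)
    degree-≅ u = begin
      G.degree u
        ≡⟨ length-as-sum (G.neighbours u) ⟩
      neighbourTotal G (const 1) u
        ≡⟨ sum-filter (u G.~?_) (const 1) (Inverse.from G.index) ⟩
      sum (λ i → ⟦ u G.~? Inverse.from G.index i ⟧ ℕ.* 1)
        ≡⟨ sum-cong-≗ (λ i → cong (ℕ._* 1) (≡.trans
             (⟦⟧-cong (proj₂ G≅H u (Inverse.from G.index i)) (u G.~? _) (to u H.~? _))
             (cong (λ v → ⟦ to u H.~? v ⟧) (≡.sym (from-reindexing i))))) ⟩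
      sum (λ i → ⟦ to u H.~? Inverse.from H.index (reindexing ⟨$⟩ʳ i) ⟧ ℕ.* 1)
        ≡⟨ sum-permute (λ k → ⟦ to u H.~? Inverse.from H.index k ⟧ ℕ.* 1) reindexing ⟨
      sum (λ k → ⟦ to u H.~? Inverse.from H.index k ⟧ ℕ.* 1)
        ≡⟨ sum-filter (to u H.~?_) (const 1) (Inverse.from H.index) ⟨
      neighbourTotal H (const 1) (to u)
        ≡⟨ length-as-sum (H.neighbours (to u)) ⟨
      H.degree (to u) ∎
      where open ≡.≡-Reasoning

    degreeSequence-≅ : degreeSequence G ↭ degreeSequence H
    degreeSequence-≅ = begin
      degreeSequence G
        ≡⟨ List.tabulate-cong (λ i → ≡.trans
             (degree-≅ (Inverse.from G.index i))
             (cong H.degree (≡.sym (from-reindexing i)))) ⟩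
      tabulate (λ i → H.degree (Inverse.from H.index (reindexing ⟨$⟩ʳ i)))
        ↭⟨ tabulate-permute (H.degree ∘ Inverse.from H.index) reindexing ⟩
      degreeSequence H ∎
      where open PermutationReasoning

degreeSequence-K̂ : ∀ {r s} (A : Partition r s) →
  degreeSequence K̂[ A ] ≡ tabulate {n = r} (const r) List.++ Vec.toList (Partition.parts A)
degreeSequence-K̂ {r} A = ≡.trans (tabulate-splitAt r (Graph.degree K̂[ A ]))
  (cong₂ List._++_ (List.tabulate-cong (degree-clique A))
    (≡.trans (List.tabulate-cong (degree-pendant A)) (tabulate-lookup (Partition.parts A))))

-- Both degree sequences start with the same `r` clique entries; cancelling these from the
-- permutation leaves the lists of parts.
≅⇒≋ : ∀ {r s} (A B : Partition r s) → K̂[ A ] ≅ K̂[ B ] → A ≋ B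
≅⇒≋ {r} A B A≅B = ++-cancelˡ-↭ (tabulate {n = r} (const r))
  (≡.subst₂ _↭_ (degreeSequence-K̂ A) (degreeSequence-K̂ B) (degreeSequence-≅ K̂[ A ] K̂[ B ] A≅B))

-- Extending a matching of points to a permutation

transpose-matchˡ : ∀ {n} (i j : Fin n) → PC.transpose i j i ≡ j
transpose-matchˡ i j rewrite dec-true (i Fin.≟ i) refl = refl

transpose-mismatch : ∀ {n} {i j k : Fin n} → k ≢ i → k ≢ j → PC.transpose i j k ≡ k
transpose-mismatch {i = i} {j} {k} k≢i k≢j
  rewrite dec-false (k Fin.≟ i) k≢i | dec-false (k Fin.≟ j) k≢j = refl

-- Induction on `s`: a permutation matching all later points is followed by the transposition of the
-- current image of `t zero` with `u zero`. Injectivity of `t` and `u` keeps the later targets away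
-- from both transposed points.
extendToPermutation : ∀ {s r} (t u : Fin s → Fin r) → Injective _≡_ _≡_ t → Injective _≡_ _≡_ u →
                      Σ[ σ ∈ Permutation′ r ] (∀ j → σ ⟨$⟩ʳ t j ≡ u j)
extendToPermutation {zero}  t u t-inj u-inj = Perm.id , λ ()
extendToPermutation {suc s} t u t-inj u-inj
  with σ , σt≡u ← extendToPermutation (t ∘ suc) (u ∘ suc)
                    (Fin.suc-injective ∘ t-inj) (Fin.suc-injective ∘ u-inj)
  = σ ∘ₚ Perm.transpose (σ ⟨$⟩ʳ t zero) (u zero) , matches
  where
  matches : ∀ j → PC.transpose (σ ⟨$⟩ʳ t zero) (u zero) (σ ⟨$⟩ʳ t j) ≡ u j
  matches zero    = transpose-matchˡ (σ ⟨$⟩ʳ t zero) (u zero)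
  matches (suc j) = ≡.trans
    (cong (PC.transpose _ _) (σt≡u j))
    (transpose-mismatch
      (λ uj≡σt0 → Fin.0≢1+n (≡.sym (t-inj (Injection.injective (↔⇒↣ σ)
        (≡.trans (σt≡u j) uj≡σt0)))))
      (λ uj≡u0 → Fin.0≢1+n (≡.sym (u-inj uj≡u0))))

-- Linear functionals and operators on function spaces

module LinearAlgebra {c ℓ} (R : CommutativeRing c ℓ) where
  open CommutativeRing R hiding (zero) renaming (refl to ≈-refl; sym to ≈-sym; trans to ≈-trans)
  open IndicatorSum semiring
  open import Algebra.Properties.Ring ring
  open import Algebra.Properties.CommutativeSemigroup *-commutativeSemigroup using (x∙yz≈y∙xz)
  open import Algebra.Properties.CommutativeSemigroup +-commutativeSemigroup using (interchange)
  open import Relation.Binary.Reasoning.Setoid setoid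

  infix 4 _≐_
  _≐_ : ∀ {V : Set} → (V → Carrier) → (V → Carrier) → Set ℓ
  f ≐ g = ∀ v → f v ≈ g v

  x+[y-x]≈y : ∀ x y → x + (y - x) ≈ y
  x+[y-x]≈y x y = begin
    x + (y - x)    ≈⟨ +-comm _ _ ⟩
    y - x + x      ≈⟨ +-assoc _ _ _ ⟩
    y + (- x + x)  ≈⟨ +-congˡ (-‿inverseˡ x) ⟩
    y + 0#         ≈⟨ +-identityʳ y ⟩
    y              ∎

  [x+y]-x≈y : ∀ x y → x + y - x ≈ y
  [x+y]-x≈y x y = ≈-trans (+-assoc _ _ _) (x+[y-x]≈y x y)

  x≈y⇒x-y≈0 : ∀ {x y} → x ≈ y → x - y ≈ 0#
  x≈y⇒x-y≈0 {y = y} x≈y = ≈-trans (+-congʳ x≈y) (-‿inverseʳ y)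

  -- Functions are compared pointwise up to `≈`, so respecting this relation is part of linearity.
  record Linear {V : Set} (φ : (V → Carrier) → Carrier) : Set (c ⊔ ℓ) where
    field
      respects : ∀ {f g} → f ≐ g → φ f ≈ φ g
      linear   : ∀ x f g → φ (λ v → x * f v + g v) ≈ x * φ f + φ g

    vanishes : ∀ {f} → (∀ v → f v ≈ 0#) → φ f ≈ 0#
    vanishes {f} f≈0 = begin
      -- A zero function agrees with `- 1# * f + f`, which has the shape that `linear` accepts.
      φ f                          ≈⟨ respects (λ v → ≈-trans (f≈0 v) (≈-sym (-1f+f (f v)))) ⟩
      φ (λ v → - 1# * f v + f v)   ≈⟨ linear (- 1#) f f ⟩
      - 1# * φ f + φ f             ≈⟨ -1f+f (φ f) ⟩
      0#                           ∎
      where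
      -1f+f : ∀ x → - 1# * x + x ≈ 0#
      -1f+f x = ≈-trans (+-congʳ (-1*x≈-x x)) (-‿inverseˡ x)

    scales : ∀ x f → φ (λ v → x * f v) ≈ x * φ f
    scales x f = begin
      φ (λ v → x * f v)         ≈⟨ respects (λ v → ≈-sym (+-identityʳ _)) ⟩
      φ (λ v → x * f v + 0#)    ≈⟨ linear x f (const 0#) ⟩
      x * φ f + φ (const 0#)    ≈⟨ +-congˡ (vanishes (λ _ → ≈-refl)) ⟩
      x * φ f + 0#              ≈⟨ +-identityʳ _ ⟩
      x * φ f                   ∎

    adds : ∀ f g → φ (λ v → f v + g v) ≈ φ f + φ g
    adds f g = begin
      φ (λ v → f v + g v)         ≈⟨ respects (λ v → +-congʳ (≈-sym (*-identityˡ _))) ⟩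
      φ (λ v → 1# * f v + g v)    ≈⟨ linear 1# f g ⟩
      1# * φ f + φ g              ≈⟨ +-congʳ (*-identityˡ _) ⟩
      φ f + φ g                   ∎

    subtracts : ∀ f g → φ (λ v → f v - g v) ≈ φ f - φ g
    subtracts f g = begin
      φ (λ v → f v - g v)            ≈⟨ adds f (λ v → - g v) ⟩
      φ f + φ (λ v → - g v)          ≈⟨ +-congˡ (respects (λ v → ≈-sym (-1*x≈-x (g v)))) ⟩
      φ f + φ (λ v → - 1# * g v)     ≈⟨ +-congˡ (≈-trans (scales (- 1#) g) (-1*x≈-x _)) ⟩
      φ f - φ g                      ∎

    combines : ∀ {d} (a : Fin d → Carrier) (b : Fin d → V → Carrier) →
               φ (λ v → sum (λ i → a i * b i v)) ≈ sum (λ i → a i * φ (b i))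
    combines {zero}  a b = vanishes (λ _ → ≈-refl)
    combines {suc d} a b = ≈-trans (linear (a zero) (b zero) _)
      (+-congˡ (combines (a ∘ suc) (b ∘ suc)))

  open Linear

  LinearOperator : ∀ {V W : Set} → ((V → Carrier) → W → Carrier) → Set (c ⊔ ℓ)
  LinearOperator L = ∀ w → Linear (λ f → L f w)

  eval-linear : ∀ {V : Set} (v : V) → Linear (λ f → f v)
  eval-linear v .respects f≐g   = f≐g v
  eval-linear v .linear x f g   = ≈-refl

  *-linear : ∀ {V : Set} {φ : (V → Carrier) → Carrier} y → Linear φ → Linear (λ f → y * φ f)
  *-linear y L .respects f≐g = *-congˡ (respects L f≐g)
  *-linear {φ = φ} y L .linear x f g = begin
    y * φ (λ v → x * f v + g v)    ≈⟨ *-congˡ (linear L x f g) ⟩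
    y * (x * φ f + φ g)            ≈⟨ distribˡ _ _ _ ⟩
    y * (x * φ f) + y * φ g        ≈⟨ +-congʳ (x∙yz≈y∙xz y x (φ f)) ⟩
    x * (y * φ f) + y * φ g        ∎

  +-linear : ∀ {V : Set} {φ ψ : (V → Carrier) → Carrier} → Linear φ → Linear ψ →
             Linear (λ f → φ f + ψ f)
  +-linear L M .respects f≐g = +-cong (respects L f≐g) (respects M f≐g)
  +-linear {φ = φ} {ψ} L M .linear x f g = begin
    φ (λ v → x * f v + g v) + ψ (λ v → x * f v + g v)   ≈⟨ +-cong (linear L x f g) (linear M x f g) ⟩
    (x * φ f + φ g) + (x * ψ f + ψ g)                   ≈⟨ interchange _ _ _ _ ⟩
    x * φ f + x * ψ f + (φ g + ψ g)                     ≈⟨ +-congʳ (distribˡ _ _ _) ⟨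
    x * (φ f + ψ f) + (φ g + ψ g)                       ∎

  neg-linear : ∀ {V : Set} {φ : (V → Carrier) → Carrier} → Linear φ → Linear (λ f → - φ f)
  neg-linear L .respects f≐g = -‿cong (respects L f≐g)
  neg-linear {φ = φ} L .linear x f g = begin
    - φ (λ v → x * f v + g v)   ≈⟨ -‿cong (linear L x f g) ⟩
    - (x * φ f + φ g)           ≈⟨ -‿+-comm _ _ ⟨
    - (x * φ f) + - φ g         ≈⟨ +-congʳ (-‿distribʳ-* _ _) ⟩
    x * - φ f + - φ g           ∎

  0-linear : ∀ {V : Set} → Linear {V} (const 0#)
  0-linear .respects _     = ≈-refl
  0-linear .linear   x f g = ≈-sym (≈-trans (+-identityʳ _) (zeroʳ x))

  sum-linear : ∀ {V : Set} {n} {φ : Fin n → (V → Carrier) → Carrier} →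
               (∀ i → Linear (φ i)) → Linear (λ f → sum (λ i → φ i f))
  sum-linear {n = zero}  L = 0-linear
  sum-linear {n = suc n} L = +-linear (L zero) (sum-linear (L ∘ suc))

  ∘-linear : ∀ {V W : Set} {φ : (W → Carrier) → Carrier} {L : (V → Carrier) → W → Carrier} →
             Linear φ → LinearOperator L → Linear (φ ∘ L)
  ∘-linear Lφ LL .respects f≐g   = respects Lφ (λ w → respects (LL w) f≐g)
  ∘-linear Lφ LL .linear x f g   = ≈-trans (respects Lφ (λ w → linear (LL w) x f g)) (linear Lφ x _ _)

  total-linear : ∀ {n} → Linear (sum {n})
  total-linear = sum-linear eval-linear

  fibreSum-linear : ∀ {r s} (p : Fin r → Fin s) → LinearOperator (fibreSum p)
  fibreSum-linear p j = sum-linear (λ i → *-linear ⟦ p i Fin.≟ j ⟧ (eval-linear i))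

  -- Averages and residues along the fibres of a projection

  record Fibration (r s : ℕ) : Set (c ⊔ ℓ) where
    field
      proj           : Fin r → Fin s
      section        : Fin s → Fin r
      proj-section   : ∀ j → proj (section j) ≡ j
      -- The reciprocal fibre sizes are given as data, so the argument works over any commutative
      -- ring in which these sizes are invertible.
      weight         : Fin s → Carrier
      weight-inverse : ∀ j → weight j * fibreSum proj (const 1#) j ≈ 1#

    average : (Fin r → Carrier) → Fin s → Carrier
    average f j = weight j * fibreSum proj f j

    average-linear : LinearOperator average
    average-linear j = *-linear (weight j) (fibreSum-linear proj j)

    -- The complement of `average f ∘ proj`: together they split `f` into a pullback and a function
    -- with vanishing fibre sums.
    residue : (Fin r → Carrier) → Fin r → Carrier
    residue f i = f i - average f (proj i)

    residue-linear : LinearOperator residue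
    residue-linear i = +-linear (eval-linear i) (neg-linear (average-linear (proj i)))

    -- Places `g j` at the representative `section j` and zero off the section; a right inverse of
    -- `fibreSum proj`.
    extend : (Fin s → Carrier) → Fin r → Carrier
    extend g i = sum (λ j → ⟦ section j Fin.≟ i ⟧ * g j)

    extend-linear : LinearOperator extend
    extend-linear i = sum-linear (λ j → *-linear ⟦ section j Fin.≟ i ⟧ (eval-linear j))

    -- The projection onto the functions with vanishing fibre sums that only
    -- changes values on the section.
    balance : (Fin r → Carrier) → Fin r → Carrier
    balance f i = f i - extend (fibreSum proj f) i

    balance-linear : LinearOperator balance
    balance-linear i = +-linear (eval-linear i)
      (neg-linear (∘-linear (extend-linear i) (fibreSum-linear proj)))

    average-pullback : ∀ u → average (u ∘ proj) ≐ u
    average-pullback u j = begin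
      weight j * fibreSum proj (u ∘ proj) j            ≈⟨ *-congˡ (fibreSum-pullback proj u j) ⟩
      weight j * (fibreSum proj (const 1#) j * u j)    ≈⟨ *-assoc _ _ _ ⟨
      weight j * fibreSum proj (const 1#) j * u j      ≈⟨ *-congʳ (weight-inverse j) ⟩
      1# * u j                                         ≈⟨ *-identityˡ _ ⟩
      u j                                              ∎

    fibreSum-average : ∀ f → fibreSum proj (average f ∘ proj) ≐ fibreSum proj f
    fibreSum-average f j = begin
      fibreSum proj (average f ∘ proj) j                  ≈⟨ fibreSum-pullback proj (average f) j ⟩
      size * (weight j * fibreSum proj f j)               ≈⟨ *-assoc _ _ _ ⟨
      size * weight j * fibreSum proj f j                 ≈⟨ *-congʳ (≈-trans (*-comm _ _) (weight-inverse j)) ⟩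
      1# * fibreSum proj f j                              ≈⟨ *-identityˡ _ ⟩
      fibreSum proj f j                                   ∎
      where size = fibreSum proj (const 1#) j

    sum-average : ∀ f → sum (average f ∘ proj) ≈ sum f
    sum-average f = begin
      sum (average f ∘ proj)                    ≈⟨ sum-fibreSum proj (average f ∘ proj) ⟨
      sum (fibreSum proj (average f ∘ proj))    ≈⟨ sum-cong-≋ (fibreSum-average f) ⟩
      sum (fibreSum proj f)                     ≈⟨ sum-fibreSum proj f ⟩
      sum f                                     ∎

    fibreSum-residue : ∀ f j → fibreSum proj (residue f) j ≈ 0#
    fibreSum-residue f j = ≈-trans
      (subtracts (fibreSum-linear proj j) f (average f ∘ proj))
      (x≈y⇒x-y≈0 (≈-sym (fibreSum-average f j)))

    residue-pullback : ∀ u i → residue (u ∘ proj) i ≈ 0#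
    residue-pullback u i = x≈y⇒x-y≈0 (≈-sym (average-pullback u (proj i)))

    -- Since `section` is a right inverse of `proj`, the fibre over `j` meets the section in
    -- `section j` alone. After the sums are exchanged, the inner one collapses to that point.
    fibreSum-extend : ∀ g → fibreSum proj (extend g) ≐ g
    fibreSum-extend g j = begin
      sum (λ i → ⟦ proj i Fin.≟ j ⟧ * extend g i)
        ≈⟨ sum-cong-≋ (λ i → *-distribˡ-sum ⟦ proj i Fin.≟ j ⟧ (λ k → ⟦ section k Fin.≟ i ⟧ * g k)) ⟩
      sum (λ i → sum (λ k → ⟦ proj i Fin.≟ j ⟧ * (⟦ section k Fin.≟ i ⟧ * g k)))
        ≈⟨ ∑-comm (λ i k → ⟦ proj i Fin.≟ j ⟧ * (⟦ section k Fin.≟ i ⟧ * g k)) ⟩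
      sum (λ k → sum (λ i → ⟦ proj i Fin.≟ j ⟧ * (⟦ section k Fin.≟ i ⟧ * g k)))
        ≈⟨ sum-cong-≋ (λ k → sum-cong-≋ (λ i → x∙yz≈y∙xz ⟦ proj i Fin.≟ j ⟧ ⟦ section k Fin.≟ i ⟧ (g k))) ⟩
      sum (λ k → sum (λ i → ⟦ section k Fin.≟ i ⟧ * (⟦ proj i Fin.≟ j ⟧ * g k)))
        ≈⟨ sum-cong-≋ (λ k → sum-δ (section k) (λ i → ⟦ proj i Fin.≟ j ⟧ * g k)) ⟩
      sum (λ k → ⟦ proj (section k) Fin.≟ j ⟧ * g k)
        ≈⟨ sum-cong-≋ (λ k → *-congʳ (reflexive (⟦⟧-cong
             (mk⇔ (λ e → ≡.trans (≡.sym e) (proj-section k)) (λ e → ≡.trans (proj-section k) (≡.sym e)))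
             (proj (section k) Fin.≟ j) (j Fin.≟ k)))) ⟩
      sum (λ k → ⟦ j Fin.≟ k ⟧ * g k)
        ≈⟨ sum-δ j g ⟩
      g j ∎

    average-balance : ∀ f j → average (balance f) j ≈ 0#
    average-balance f j = ≈-trans (*-congˡ (begin
      fibreSum proj (balance f) j
        ≈⟨ subtracts (fibreSum-linear proj j) f (extend (fibreSum proj f)) ⟩
      fibreSum proj f j - fibreSum proj (extend (fibreSum proj f)) j
        ≈⟨ x≈y⇒x-y≈0 (≈-sym (fibreSum-extend (fibreSum proj f) j)) ⟩
      0# ∎)) (zeroʳ _)

    -- A function supported on the section is determined by its fibre sums, so `balance` removes it
    -- entirely.
    balance-extend : ∀ g i → balance (extend g) i ≈ 0#
    balance-extend g i = x≈y⇒x-y≈0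
      (≈-sym (respects (extend-linear i) (fibreSum-extend g)))

    balance-balanced : ∀ {f} → (∀ j → fibreSum proj f j ≈ 0#) → balance f ≐ f
    balance-balanced {f} balanced i = begin
      f i - extend (fibreSum proj f) i   ≈⟨ +-congˡ (-‿cong (vanishes (extend-linear i) balanced)) ⟩
      f i - 0#                           ≈⟨ +-congˡ -0#≈0# ⟩
      f i + 0#                           ≈⟨ +-identityʳ _ ⟩
      f i                                ∎

    section-injective : Injective _≡_ _≡_ section
    section-injective {j} {k} eq =
      ≡.trans (≡.sym (proj-section j)) (≡.trans (cong proj eq) (proj-section k))

    -- For `ρ` equal to 1/r and reciprocal block sizes as weights, this is the operator P in closed
    -- form: a clique vertex sees the whole clique except itself, and one pendant vertex.
    walk : Carrier → (Fin r ⊎ Fin s → Carrier) → Fin r ⊎ Fin s → Carrier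
    walk ρ f (inj₁ i) = ρ * ((sum (f ∘ inj₁) + f (inj₂ (proj i))) - f (inj₁ i))
    walk ρ f (inj₂ j) = average (f ∘ inj₁) j

  open Fibration

  -- The conjugating map between two fibrations

  module Transfer {r s} (ρ : Carrier) (ρ-inverse : ρ * sum {r} (const 1#) ≈ 1#)
                  (A B : Fibration r s) (σ : Permutation′ r)
                  (σ-section : ∀ j → σ ⟨$⟩ʳ section A j ≡ section B j) where

    -- a(u) - b(u), writing the weighted sum Σⱼ aⱼuⱼ as the total of a pullback.
    discrepancy : (Fin s → Carrier) → Carrier
    discrepancy u = sum (u ∘ proj A) - sum (u ∘ proj B)

    shift : (Fin s → Carrier) → Fin s → Carrier
    shift u j = u j + ρ * discrepancy u

    -- The value at `k` moves to `σ ⟨$⟩ʳ k`, hence the inverse direction of `σ` in the argument.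
    permute : (Fin r → Carrier) → Fin r → Carrier
    permute f i = f (σ ⟨$⟩ˡ i)

    -- The pullback part is changed by `shift`, the residue is transported by `σ`. As `σ` matches
    -- sections but need not match fibres, the transported residue is rebalanced for `B`.
    onClique : (Fin r → Carrier) → Fin r → Carrier
    onClique f i = shift (average A f) (proj B i) + balance B (permute (residue A f)) i

    transfer : (Fin r ⊎ Fin s → Carrier) → Fin r ⊎ Fin s → Carrier
    transfer f (inj₁ i) = onClique (f ∘ inj₁) i
    transfer f (inj₂ j) = shift (f ∘ inj₂) j

    shift-linear : LinearOperator shift
    shift-linear j = +-linear (eval-linear j) (*-linear ρ (+-linear
      (∘-linear total-linear (λ i → eval-linear (proj A i)))
      (neg-linear (∘-linear total-linear (λ i → eval-linear (proj B i))))))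

    permute-linear : LinearOperator permute
    permute-linear i = eval-linear (σ ⟨$⟩ˡ i)

    onClique-linear : LinearOperator onClique
    onClique-linear i = +-linear
      (∘-linear (shift-linear (proj B i)) (average-linear A))
      (∘-linear (balance-linear B i) (λ k → ∘-linear (permute-linear k) (residue-linear A)))

    transfer-linear : LinearOperator transfer
    transfer-linear (inj₁ i) = ∘-linear (onClique-linear i) (λ k → eval-linear (inj₁ k))
    transfer-linear (inj₂ j) = ∘-linear (shift-linear j) (λ k → eval-linear (inj₂ k))

    sum-const-ρ : ∀ δ → sum {r} (const (ρ * δ)) ≈ δ
    sum-const-ρ δ = begin
      sum {r} (const (ρ * δ))              ≈⟨ sum-cong-≋ {r} (λ _ → *-identityˡ _) ⟨
      sum {r} (const (1# * (ρ * δ)))       ≈⟨ *-distribʳ-sum {r} (ρ * δ) (const 1#) ⟨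
      sum {r} (const 1#) * (ρ * δ)         ≈⟨ *-assoc _ _ _ ⟨
      sum {r} (const 1#) * ρ * δ           ≈⟨ *-congʳ (≈-trans (*-comm _ _) ρ-inverse) ⟩
      1# * δ                               ≈⟨ *-identityˡ δ ⟩
      δ                                    ∎

    sum-shift : ∀ (p : Fin r → Fin s) u → sum (shift u ∘ p) ≈ sum (u ∘ p) + discrepancy u
    sum-shift p u = ≈-trans (∑-distrib-+ (u ∘ p) (const (ρ * discrepancy u)))
      (+-congˡ (sum-const-ρ (discrepancy u)))

    -- This is the sense in which `shift` carries a to b: adding `ρ * δ` at each of the `r` points
    -- raises the total by δ, and b(u) + (a(u) - b(u)) = a(u).
    sum-shift-proj : ∀ u → sum (shift u ∘ proj B) ≈ sum (u ∘ proj A)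
    sum-shift-proj u = ≈-trans (sum-shift (proj B) u) (x+[y-x]≈y _ _)

    shift-const : ∀ x → shift (const x) ≐ const x
    shift-const x j = begin
      -- Both pullbacks of a constant are the same constant function on `Fin r`, so the two totals
      -- are literally equal.
      x + ρ * discrepancy (const x)   ≈⟨ +-congˡ (*-congˡ (-‿inverseʳ (sum {r} (const x)))) ⟩
      x + ρ * 0#                      ≈⟨ +-congˡ (zeroʳ ρ) ⟩
      x + 0#                          ≈⟨ +-identityʳ x ⟩
      x                               ∎

    average-onClique : ∀ f → average B (onClique f) ≐ shift (average A f)
    average-onClique f j = begin
      average B (onClique f) j
        ≈⟨ adds (average-linear B j) (shift (average A f) ∘ proj B) (balance B (permute (residue A f))) ⟩
      average B (shift (average A f) ∘ proj B) j + average B (balance B (permute (residue A f))) j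
        ≈⟨ +-cong (average-pullback B (shift (average A f)) j) (average-balance B (permute (residue A f)) j) ⟩
      shift (average A f) j + 0#
        ≈⟨ +-identityʳ _ ⟩
      shift (average A f) j ∎

    residue-onClique : ∀ f → residue B (onClique f) ≐ balance B (permute (residue A f))
    residue-onClique f i = ≈-trans
      (+-congˡ (-‿cong (average-onClique f (proj B i))))
      ([x+y]-x≈y _ _)

    onClique-pullback : ∀ u → onClique (u ∘ proj A) ≐ shift u ∘ proj B
    onClique-pullback u i = begin
      onClique (u ∘ proj A) i
        ≈⟨ +-cong
             (respects (shift-linear (proj B i)) (average-pullback A u))
             (vanishes (balance-linear B i) (λ k → residue-pullback A u (σ ⟨$⟩ˡ k))) ⟩
      shift u (proj B i) + 0#
        ≈⟨ +-identityʳ _ ⟩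
      shift u (proj B i) ∎

    -- The rebalanced residue has zero average for `B` and contributes nothing to the total, while
    -- `shift` turns the `B`-total of the pullback part into its `A`-total.
    sum-onClique : ∀ f → sum (onClique f) ≈ sum f
    sum-onClique f = begin
      sum (onClique f)                          ≈⟨ sum-average B (onClique f) ⟨
      sum (average B (onClique f) ∘ proj B)     ≈⟨ sum-cong-≋ (λ i → average-onClique f (proj B i)) ⟩
      sum (shift (average A f) ∘ proj B)        ≈⟨ sum-shift-proj (average A f) ⟩
      sum (average A f ∘ proj A)                ≈⟨ sum-average A f ⟩
      sum f                                     ∎

    -- Holds because `σ` sends the representative of each `A`-fibre to that of the `B`-fibre with
    -- the same index.
    permute-extend : ∀ g → permute (extend A g) ≐ extend B g
    permute-extend g i = sum-cong-≋ (λ j → *-congʳ (reflexive (⟦⟧-cong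
      (mk⇔ (λ e → ≡.trans (≡.sym (σ-section j)) (≡.trans (cong (σ ⟨$⟩ʳ_) e) (inverseʳ σ)))
           (λ e → ≡.trans (≡.sym (inverseˡ σ)) (cong (σ ⟨$⟩ˡ_) (≡.trans (σ-section j) e))))
      (section A j Fin.≟ σ ⟨$⟩ˡ i) (section B j Fin.≟ i))))

    -- On the clique, the walk is `ρ` times a pullback minus the function itself, and `onClique`
    -- carries pullbacks to pullbacks through `shift`. On the pendant vertices the walk is
    -- `average`, which `onClique` turns into `shift` of the average.
    transfer-intertwines : ∀ f → transfer (walk A ρ f) ≐ walk B ρ (transfer f)
    transfer-intertwines f (inj₂ j) = ≈-sym (average-onClique (f ∘ inj₁) j)
    transfer-intertwines f (inj₁ i) = begin
      onClique (λ k → ρ * ((ν + g (proj A k)) - h k)) i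
        ≈⟨ scales (onClique-linear i) ρ (λ k → (ν + g (proj A k)) - h k) ⟩
      ρ * onClique (λ k → (ν + g (proj A k)) - h k) i
        ≈⟨ *-congˡ (subtracts (onClique-linear i) (λ k → ν + g (proj A k)) h) ⟩
      ρ * (onClique (λ k → ν + g (proj A k)) i - onClique h i)
        ≈⟨ *-congˡ (+-congʳ (begin
             onClique (λ k → ν + g (proj A k)) i
               ≈⟨ onClique-pullback (λ j → ν + g j) i ⟩
             shift (λ j → ν + g j) (proj B i)
               ≈⟨ adds (shift-linear (proj B i)) (const ν) g ⟩
             shift (const ν) (proj B i) + shift g (proj B i)
               -- The constant `ν` is fixed by `shift` and equals the clique total of the
               -- transferred function.
               ≈⟨ +-congʳ (≈-trans (shift-const ν (proj B i)) (≈-sym (sum-onClique h))) ⟩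
             sum (onClique h) + shift g (proj B i) ∎)) ⟩
      ρ * ((sum (onClique h) + shift g (proj B i)) - onClique h i) ∎
      where
      h = f ∘ inj₁
      g = f ∘ inj₂
      ν = sum h

  -- The transfers in the two directions are mutually inverse

  module _ {r s} (ρ : Carrier) (ρ-inverse : ρ * sum {r} (const 1#) ≈ 1#)
           (A B : Fibration r s) (σ : Permutation′ r)
           (σ-section : ∀ j → σ ⟨$⟩ʳ section A j ≡ section B j) where

    flip-section : ∀ j → Perm.flip σ ⟨$⟩ʳ section B j ≡ section A j
    flip-section j = ≡.trans (cong (σ ⟨$⟩ˡ_) (≡.sym (σ-section j))) (inverseˡ σ)

    private
      module A→B = Transfer ρ ρ-inverse A B σ σ-section
      module B→A = Transfer ρ ρ-inverse B A (Perm.flip σ) flip-section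

    -- On `shift u` the reverse discrepancy is a - (a + δ), that is -δ, so the second shift undoes
    -- the first.
    shift-inverse : ∀ u → B→A.shift (A→B.shift u) ≐ u
    shift-inverse u j = begin
      u j + ρ * δ + ρ * B→A.discrepancy (A→B.shift u)
        ≈⟨ +-congˡ (*-congˡ (+-cong (A→B.sum-shift-proj u) (-‿cong (A→B.sum-shift (proj A) u)))) ⟩
      u j + ρ * δ + ρ * (a - (a + δ))
        ≈⟨ +-assoc _ _ _ ⟩
      u j + (ρ * δ + ρ * (a - (a + δ)))
        ≈⟨ +-congˡ (distribˡ ρ _ _) ⟨
      u j + ρ * (δ + (a - (a + δ)))
        ≈⟨ +-congˡ (*-congˡ (begin
             δ + (a - (a + δ))   ≈⟨ +-assoc _ _ _ ⟨
             δ + a - (a + δ)     ≈⟨ x≈y⇒x-y≈0 (+-comm δ a) ⟩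
             0#                  ∎)) ⟩
      u j + ρ * 0#
        ≈⟨ +-congˡ (zeroʳ ρ) ⟩
      u j + 0#
        ≈⟨ +-identityʳ _ ⟩
      u j ∎
      where
      a = sum (u ∘ proj A)
      δ = A→B.discrepancy u

    -- Balancing for `B` subtracts a function supported on the section of `B`. Permuted back, it is
    -- supported on the section of `A` and is killed by `balance A`, which fixes the balanced `h`.
    balance-inverse : ∀ {h} → (∀ j → fibreSum (proj A) h j ≈ 0#) →
                      balance A (B→A.permute (balance B (A→B.permute h))) ≐ h
    balance-inverse {h} balanced i = begin
      balance A (λ k → h (σ ⟨$⟩ˡ (σ ⟨$⟩ʳ k)) - B→A.permute (extend B g) k) i
        ≈⟨ respects (balance-linear A i) (λ k → +-cong
             (reflexive (cong h (inverseˡ σ)))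
             (-‿cong (B→A.permute-extend g k))) ⟩
      balance A (λ k → h k - extend A g k) i
        ≈⟨ subtracts (balance-linear A i) h (extend A g) ⟩
      balance A h i - balance A (extend A g) i
        ≈⟨ +-cong (balance-balanced A balanced i) (-‿cong (balance-extend A g i)) ⟩
      h i - 0#
        ≈⟨ +-congˡ -0#≈0# ⟩
      h i + 0#
        ≈⟨ +-identityʳ _ ⟩
      h i ∎
      where
      g = fibreSum (proj B) (A→B.permute h)

    transfer-inverse : ∀ f → B→A.transfer (A→B.transfer f) ≐ f
    transfer-inverse f (inj₂ j) = shift-inverse (f ∘ inj₂) j
    transfer-inverse f (inj₁ i) = begin
      B→A.shift (average B (A→B.onClique h)) (proj A i) +
      balance A (B→A.permute (residue B (A→B.onClique h))) i
        ≈⟨ +-cong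
             (respects (B→A.shift-linear (proj A i)) (A→B.average-onClique h))
             (respects (balance-linear A i) (λ k → A→B.residue-onClique h (σ ⟨$⟩ʳ k))) ⟩
      B→A.shift (A→B.shift (average A h)) (proj A i) +
      balance A (B→A.permute (balance B (A→B.permute (residue A h)))) i
        ≈⟨ +-cong (shift-inverse (average A h) (proj A i)) (balance-inverse (fibreSum-residue A h) i) ⟩
      average A h (proj A i) + residue A h i
        ≈⟨ x+[y-x]≈y _ _ ⟩
      h i ∎
      where h = f ∘ inj₁

-- Similar operators have the same multiplicities

module SpectralTransfer {c ℓ₁ ℓ₂} (F : HeytingField c ℓ₁ ℓ₂) where
  R : CommutativeRing c ℓ₁
  R = HeytingCommutativeRing.commutativeRing (HeytingField.heytingCommutativeRing F)

  open Spectral F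
  open HeytingField F using (#⇒invertible)
  open CommutativeRing R hiding (zero) renaming (refl to ≈-refl; sym to ≈-sym; trans to ≈-trans)
  open IndicatorSum semiring
  open LinearAlgebra R
  open Linear
  open import Algebra.Properties.Ring ring
  open import Algebra.Definitions.RawMonoid +-rawMonoid using () renaming (_×_ to _·_)
  open import Relation.Binary.Reasoning.Setoid setoid

  -- Both intertwining laws are fields because an `Operator` is not assumed to respect `≐`.
  record Similarity {V W : Set} (T : Operator V) (U : Operator W) : Set (c ⊔ ℓ₁) where
    field
      to               : (V → Carrier) → W → Carrier
      from             : (W → Carrier) → V → Carrier
      to-linear        : LinearOperator to
      from-linear      : LinearOperator from
      from∘to          : ∀ f → from (to f) ≐ f
      to∘from          : ∀ f → to (from f) ≐ f
      to-intertwines   : ∀ f → to (T f) ≐ U (to f)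
      from-intertwines : ∀ f → from (U f) ≐ T (from f)

    multiplicity : ∀ μ d → HasMultiplicity T μ d → HasMultiplicity U μ d
    multiplicity μ d (b , basis) = to ∘ b , record
      { inEigenspace = λ i w → begin
          U (to (b i)) w               ≈⟨ to-intertwines (b i) w ⟨
          to (T (b i)) w               ≈⟨ respects (to-linear w) (inEigenspace i) ⟩
          to (λ v → μ * b i v) w       ≈⟨ scales (to-linear w) μ (b i) ⟩
          μ * to (b i) w               ∎
      -- A vanishing combination of the images is the image of the combination, which `from`
      -- recovers as zero.
      ; independent = λ a combination≈0 → independent a (λ v → begin
          combination a b v                   ≈⟨ from∘to (combination a b) v ⟨
          from (to (combination a b)) v       ≈⟨ vanishes (from-linear v) (λ w →
                                                   ≈-trans (combines (to-linear w) a b) (combination≈0 w)) ⟩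
          0#                                  ∎)
      ; spanning = λ f f∈E →
          let a , f≈ = spanning (from f) (λ v → begin
                T (from f) v              ≈⟨ from-intertwines f v ⟨
                from (U f) v              ≈⟨ respects (from-linear v) f∈E ⟩
                from (λ w → μ * f w) v    ≈⟨ scales (from-linear v) μ f ⟩
                μ * from f v              ∎)
          in a , λ w → begin
                f w                       ≈⟨ to∘from f w ⟨
                to (from f) w             ≈⟨ respects (to-linear w) f≈ ⟩
                to (combination a b) w    ≈⟨ combines (to-linear w) a b ⟩
                combination a (to ∘ b) w  ∎
      }
      where open IsEigenbasis basis

  open Similarity

  Similarity-sym : ∀ {V W : Set} {T : Operator V} {U : Operator W} → Similarity T U → Similarity U T
  Similarity-sym S = record
    { to = from S ; from = to S
    ; to-linear = from-linear S ; from-linear = to-linear S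
    ; from∘to = to∘from S ; to∘from = from∘to S
    ; to-intertwines = from-intertwines S ; from-intertwines = to-intertwines S
    }

  similar⇒isospectral : ∀ {V W : Set} {T : Operator V} {U : Operator W} →
                        Similarity T U → Isospectral T U
  similar⇒isospectral S μ d = mk⇔ (multiplicity S μ d) (multiplicity (Similarity-sym S) μ d)

  -- Application to the normalised adjacency operators

  module _ (char0 : CharacteristicZero) where

    1/-inverse : ∀ {n} → 0 < n → (1/_) char0 n * (n · 1#) ≈ 1#
    1/-inverse {suc n} _ = begin
      -- Apartness from `0#` yields an inverse of the difference with `0#`, hence the subtraction.
      (1/_) char0 (suc n) * (suc n · 1#)          ≈⟨ *-congˡ (≈-trans (+-congˡ -0#≈0#) (+-identityʳ _)) ⟨
      (1/_) char0 (suc n) * (suc n · 1# - 0#)     ≈⟨ proj₁ (proj₂ (#⇒invertible (char0 n))) ⟩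
      1#                                          ∎

    neighbourTotal-one : ∀ G v → neighbourTotal G (const 1#) v ≈ Graph.degree G v · 1#
    neighbourTotal-one G v = count (Graph.neighbours G v)
      where
      count : ∀ {a} {A : Set a} (xs : List A) →
              foldr _+_ 0# (List.map (const 1#) xs) ≈ length xs · 1#
      count []       = ≈-refl
      count (_ ∷ xs) = +-congˡ (count xs)

    fibration : ∀ {r s} → Partition r s → Fibration r s
    fibration A = record
      { proj           = block A
      ; section        = proj₁ ∘ block-surjective A
      ; proj-section   = proj₂ ∘ block-surjective A
      -- The reciprocal of the degree makes `average` match the pendant rows of P; positivity of the
      -- parts keeps it off the default value of `1/_` at zero.
      ; weight         = λ j → (1/_) char0 (degree (inj₂ j))
      ; weight-inverse = λ j → begin
          (1/_) char0 (degree (inj₂ j)) * fibreSum (block A) (const 1#) j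
            ≈⟨ *-congˡ (≈-trans (≈-sym (neighbourTotal-pendant A (const 1#) j))
                                (neighbourTotal-one K̂[ A ] (inj₂ j))) ⟩
          (1/_) char0 (degree (inj₂ j)) * (degree (inj₂ j) · 1#)
            ≈⟨ 1/-inverse (≡.subst (0 <_) (≡.sym (degree-pendant A j)) (All.lookup⁺ (Partition.positive A) j)) ⟩
          1# ∎
      }
      where open Graph K̂[ A ]

    normalisedAdjacency : ∀ G → Operator (Graph.Vertex G)
    normalisedAdjacency G f v = (1/_) char0 (Graph.degree G v) * neighbourSum char0 G f v

    module _ {r s : ℕ} (0<r : 0 < r) where

      ρ : Carrier
      ρ = (1/_) char0 r

      ρ-inverse : ρ * sum {r} (const 1#) ≈ 1#
      ρ-inverse = ≈-trans (*-congˡ (sum-replicate r)) (1/-inverse 0<r)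

      normalisedAdjacency≐walk : ∀ (A : Partition r s) f →
        normalisedAdjacency K̂[ A ] f ≐ Fibration.walk (fibration A) ρ f
      normalisedAdjacency≐walk A f (inj₂ j) = *-congˡ (neighbourTotal-pendant A f j)
      normalisedAdjacency≐walk A f (inj₁ i) = *-cong
        (reflexive (cong ((1/_) char0) (degree-clique A i)))
        (begin
          -- `neighbourTotal-clique` gives `N` after `f (inj₁ i)` has been added, so this value is
          -- added and subtracted.
          N                                               ≈⟨ [x+y]-x≈y _ _ ⟨
          f (inj₁ i) + N - f (inj₁ i)                     ≈⟨ +-congʳ (+-comm _ _) ⟩
          N + f (inj₁ i) - f (inj₁ i)                     ≈⟨ +-congʳ (neighbourTotal-clique A f i) ⟩
          sum (f ∘ inj₁) + f (inj₂ (block A i)) - f (inj₁ i)  ∎)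
        where N = neighbourTotal K̂[ A ] f (inj₁ i)

      module _ (A B : Partition r s) where
        private
          module FA = Fibration (fibration A)
          module FB = Fibration (fibration B)

        alignment : Σ[ σ ∈ Permutation′ r ] (∀ j → σ ⟨$⟩ʳ FA.section j ≡ FB.section j)
        alignment = extendToPermutation FA.section FB.section FA.section-injective FB.section-injective

        private
          σ = proj₁ alignment
          σ-section = proj₂ alignment
          σ⁻¹-section = flip-section ρ ρ-inverse (fibration A) (fibration B) σ σ-section
          module A→B = Transfer ρ ρ-inverse (fibration A) (fibration B) σ σ-section
          module B→A = Transfer ρ ρ-inverse (fibration B) (fibration A) (Perm.flip σ) σ⁻¹-section

        normalisedAdjacency-similar :
          Similarity (normalisedAdjacency K̂[ A ]) (normalisedAdjacency K̂[ B ])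
        normalisedAdjacency-similar = record
          { to               = A→B.transfer
          ; from             = B→A.transfer
          ; to-linear        = A→B.transfer-linear
          ; from-linear      = B→A.transfer-linear
          ; from∘to          = transfer-inverse ρ ρ-inverse (fibration A) (fibration B) σ σ-section
          -- With the roles swapped, the flipped `Perm.flip σ` has the same two maps as `σ`, so its
          -- transfer is `A→B.transfer` by computation.
          ; to∘from          = transfer-inverse ρ ρ-inverse (fibration B) (fibration A) (Perm.flip σ) σ⁻¹-section
          ; to-intertwines   = λ f v → ≈-trans
              (respects (A→B.transfer-linear v) (normalisedAdjacency≐walk A f))
              (≈-trans (A→B.transfer-intertwines f v)
                (≈-sym (normalisedAdjacency≐walk B (A→B.transfer f) v)))
          ; from-intertwines = λ f v → ≈-trans
              (respects (B→A.transfer-linear v) (normalisedAdjacency≐walk B f))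
              (≈-trans (B→A.transfer-intertwines f v)
                (≈-sym (normalisedAdjacency≐walk A (B→A.transfer f) v)))
          }

    module _ (G H : Graph) (S : Similarity (normalisedAdjacency G) (normalisedAdjacency H)) where

      -- A linear map commutes with the identity, so a similarity of P is also one of I - P and,
      -- likewise, of I + P.
      Δ-similar : Similarity (Δ char0 G) (Δ char0 H)
      Δ-similar = record
        { to = to S ; from = from S
        ; to-linear = to-linear S ; from-linear = from-linear S
        ; from∘to = from∘to S ; to∘from = to∘from S
        ; to-intertwines = λ f v → ≈-trans
            (subtracts (to-linear S v) f (normalisedAdjacency G f))
            (+-congˡ (-‿cong (to-intertwines S f v)))
        ; from-intertwines = λ f v → ≈-trans
            (subtracts (from-linear S v) f (normalisedAdjacency H f))
            (+-congˡ (-‿cong (from-intertwines S f v)))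
        }

      Δ⁺-similar : Similarity (Δ⁺ char0 G) (Δ⁺ char0 H)
      Δ⁺-similar = record
        { to = to S ; from = from S
        ; to-linear = to-linear S ; from-linear = from-linear S
        ; from∘to = from∘to S ; to∘from = to∘from S
        ; to-intertwines = λ f v → ≈-trans
            (adds (to-linear S v) f (normalisedAdjacency G f))
            (+-congˡ (to-intertwines S f v))
        ; from-intertwines = λ f v → ≈-trans
            (adds (from-linear S v) f (normalisedAdjacency H f))
            (+-congˡ (from-intertwines S f v))
        }

mainTheorem5 : ∀ {c ℓ₁ ℓ₂} (F : HeytingField c ℓ₁ ℓ₂) (char0 : Spectral.CharacteristicZero F) →
    let open Spectral F in
    ∀ (r s : ℕ) → 4 ≤ r → 2 ≤ s → s < r →
    (A B : Partition r s) → ¬ (A ≋ B) →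
    ¬ (K̂[ A ] ≅ K̂[ B ])
    × Isospectral (Δ char0 K̂[ A ]) (Δ char0 K̂[ B ])
    × Isospectral (Δ⁺ char0 K̂[ A ]) (Δ⁺ char0 K̂[ B ])
mainTheorem5 F char0 r s 4≤r 2≤s s<r A B A≇B =
    A≇B ∘ ≅⇒≋ A B
  , similar⇒isospectral (Δ-similar char0 K̂[ A ] K̂[ B ] similar)
  , similar⇒isospectral (Δ⁺-similar char0 K̂[ A ] K̂[ B ] similar)
  where
  open SpectralTransfer F
  -- `4 ≤ r` yields `0 < r`, which makes `ρ` a genuine inverse of the clique degree.
  similar = normalisedAdjacency-similar char0 (ℕ.≤-trans (ℕ.s≤s ℕ.z≤n) 4≤r) A B
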